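{- There is no finite (deterministic) matrix $\mathbb{M}$ such that $\vdash_{\mathbb{B}_\diamond}=\vdash_{\mathbb{M}}$ or $\rhd_{\mathbb{B}_\diamond}=\rhd_{\mathbb{M}}$.
   Context: $\mathbb{B}_\diamond=\langle\{0,1\},\cdot,\{1\}\rangle$ is the two-valued Nmatrix with one binary connective $\diamond$ (platypus) interpreted by $\diamond(0,0)=\{0\}$, $\diamond(1,1)=\{1\}$, $\diamond(0,1)=\diamond(1,0)=\{0,1\}$. For an Nmatrix/matrix $\mathbb{M}$ with designated set $D$, $\Gamma\rhd_{\mathbb{M}}\Delta$ iff every $\mathbb{M}$-valuation $v$ with $v(\Gamma)\subseteq D$ has $v(\Delta)\cap D\neq\emptyset$, and $\vdash_{\mathbb{M}}$ is its single-conclusion fragment ($\Gamma\vdash_{\mathbb{M}}\varphi$ iff $\Gamma\rhd_{\mathbb{M}}\{\varphi\}$). -}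

module Defs where

open import Data.Bool.Base using (Bool; true; false)
open import Data.Fin.Base using (Fin)
open import Data.Nat.Base using (ℕ)
open import Data.Product.Base using (∃-syntax; _×_; _,_)
open import Function.Bundles using (_↔_)
open import Level using (0ℓ)
open import Relation.Binary.Core using (REL)
open import Relation.Binary.PropositionalEquality.Core using (_≡_; refl)
open import Relation.Unary using (Pred; _∈_; _⊆_; _≐_; _≬_; ｛_｝; U; Satisfiable)

infixl 7 _◇_

data Formula : Set where
  var : ℕ → Formula
  _◇_ : Formula → Formula → Formula

record Nmatrix : Set₁ where
  field
    Value      : Set
    op         : Value → Value → Pred Value 0ℓ
    op-total   : ∀ x y → Satisfiable (op x y)
    Designated : Pred Value 0ℓ

module _ (M : Nmatrix) where
  open Nmatrix M

  IsValuation : Pred (Formula → Value) 0ℓ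
  IsValuation v = ∀ φ ψ → v (φ ◇ ψ) ∈ op (v φ) (v ψ)

  Finite : Set
  Finite = ∃[ n ] (Value ↔ Fin n)

  -- Logical matrices are the Nmatrices whose truth table has only
  -- singleton entries.
  Deterministic : Set
  Deterministic = ∀ x y → ∃[ z ] (op x y ≐ ｛ z ｝)

image : {A B : Set} → (A → B) → Pred A 0ℓ → Pred B 0ℓ
image f P y = ∃[ x ] (x ∈ P × f x ≡ y)

▷[_] : Nmatrix → REL (Pred Formula 0ℓ) (Pred Formula 0ℓ) 0ℓ
▷[ M ] Γ Δ =
  ∀ v → IsValuation M v → image v Γ ⊆ Designated → image v Δ ≬ Designated
  where open Nmatrix M

⊢[_] : Nmatrix → REL (Pred Formula 0ℓ) Formula 0ℓ
⊢[ M ] Γ φ = ▷[ M ] Γ ｛ φ ｝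

platypus : Bool → Bool → Pred Bool 0ℓ
platypus false false = ｛ false ｝
platypus true  true  = ｛ true ｝
platypus false true  = U
platypus true  false = U

platypus-total : ∀ x y → Satisfiable (platypus x y)
platypus-total false false = false , refl
platypus-total true  true  = true , refl
platypus-total false true  = false , _
platypus-total true  false = false , _

-- The truth values 0 and 1 are false and true.
𝔹◇ : Nmatrix
𝔹◇ = record
  { Value      = Bool
  ; op         = platypus
  ; op-total   = platypus-total
  ; Designated = ｛ true ｝
  }

{-# OPTIONS --safe #-}

-- Let φₙ = p ◇ (p ◇ ⋯ (p ◇ q)) with n occurrences of p.  In a deterministic
-- matrix, v φₙ is the n-th iterate of the operation with first argument v p,
-- applied to v q.  Over finitely many values these iterates repeat, so φₘ
-- entails φₙ for some m < n.  In 𝔹◇ this fails: with v p = 0 and v q = 1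
-- the chain may take the value 1 up to φₘ and 0 from there on.
module Submission where

open import Defs
open import Data.Bool.Base using (Bool; true; false)
open import Data.Bool.Properties using (T-≡; ¬-not)
open import Data.Fin.Base using (Fin; toℕ; funToFin; finToFun)
open import Data.Fin.Properties using (pigeonhole; finToFun-funToFin)
open import Data.Nat.Base using (ℕ; zero; suc; _^_; _≤_; _<_; _≤ᵇ_)
open import Data.Nat.GeneralisedArithmetic using (fold)
open import Data.Nat.Properties using (≤⇒≤ᵇ; ≤ᵇ⇒≤; ≤-refl; <⇒≤; <⇒≱; n<1+n)
open import Data.Product.Base using (Σ-syntax; ∃₂; _×_; _,_; proj₁; proj₂)
open import Data.Sum.Base using (_⊎_; inj₁; inj₂)
open import Function.Base using (_∘_)
open import Function.Bundles using (Equivalence; Injection; Inverse; _↔_)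
open import Function.Properties.Inverse using (↔⇒↣)
open import Relation.Binary.Core using (_⇔_)
open import Relation.Binary.PropositionalEquality
  using (_≡_; _≗_; refl; sym; trans; cong; subst₂; module ≡-Reasoning)
open import Relation.Nullary.Negation.Core using (¬_)
open import Relation.Unary using (｛_｝)

chain : ℕ → Formula
chain = fold (var 1) (var 0 ◇_)

funToFin-injective : ∀ {m n} {f g : Fin m → Fin n} → funToFin f ≡ funToFin g → f ≗ g
funToFin-injective {f = f} {g} eq x = begin
  f x                      ≡⟨ finToFun-funToFin f x ⟨
  finToFun (funToFin f) x  ≡⟨ cong (λ c → finToFun c x) eq ⟩
  finToFun (funToFin g) x  ≡⟨ finToFun-funToFin g x ⟩
  g x                      ∎
  where open ≡-Reasoning

-- The pigeonhole principle is applied to whole binary operations, of which `Fin n` carries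
-- `(n ^ n) ^ n`. So one pair `i`, `j` serves all `x` and `y` at once, hence all valuations.
iterates-repeat : ∀ {A : Set} {n} → A ↔ Fin n → (f : A → A → A) →
                  ∃₂ λ i j → i < j × (∀ x y → fold y (f x) i ≡ fold y (f x) j)
iterates-repeat {n = n} A↔Fin f =
  let i , j , i<j , eq = pigeonhole (n<1+n ((n ^ n) ^ n)) (code ∘ toℕ) in
  toℕ i , toℕ j , i<j , λ x y →
    -- Equal codes give agreement only at arguments of the form `from a`; every `x` is one, namely
    -- `from (to x)`.
    subst₂ (λ x y → fold y (f x) (toℕ i) ≡ fold y (f x) (toℕ j))
      (strictlyInverseʳ x) (strictlyInverseʳ y)
      (injective (funToFin-injective (funToFin-injective eq (to x)) (to y)))
  where
  open Inverse A↔Fin using (to; from; strictlyInverseʳ)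
  open Injection (↔⇒↣ A↔Fin) using (injective)
  code : ℕ → Fin ((n ^ n) ^ n)
  code k = funToFin λ x → funToFin λ y → to (fold (from y) (f (from x)) k)

module _ (M : Nmatrix) (det : Deterministic M) where
  open Nmatrix M

  detOp : Value → Value → Value
  detOp x y = proj₁ (det x y)

  value-chain : ∀ {v} → IsValuation M v → ∀ n →
                v (chain n) ≡ fold (v (var 1)) (detOp (v (var 0))) n
  value-chain     val zero    = refl
  value-chain {v} val (suc n) = trans
    -- A valuation only has to pick an element of `op`; here that set is a singleton, which forces
    -- the value.
    (sym (proj₁ (proj₂ (det (v (var 0)) (v (chain n)))) (val (var 0) (chain n))))
    (cong (detOp (v (var 0))) (value-chain val n))

  chain-entails : Finite M → ∃₂ λ i j → i < j × ⊢[ M ] ｛ chain i ｝ (chain j)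
  chain-entails (_ , V↔Fin) with iterates-repeat V↔Fin detOp
  ... | i , j , i<j , agree = i , j , i<j , λ v val designated →
    v (chain j) , (chain j , refl , refl) ,
    designated (chain i , refl ,
      trans (value-chain val i) (trans (agree _ _) (sym (value-chain val j))))

-- Recovers `n` from `chain n`, so that a valuation can switch at a given position of the chain.
rightDepth : Formula → ℕ
rightDepth (var _) = 0
rightDepth (φ ◇ ψ) = suc (rightDepth ψ)

rightDepth-chain : ∀ n → rightDepth (chain n) ≡ n
rightDepth-chain zero    = refl
rightDepth-chain (suc n) = cong suc (rightDepth-chain n)

-- The bit `b` settles the entries that `platypus` leaves open; the forced entries ignore it.
resolve : Bool → Bool → Bool → Bool
resolve b false false = false
resolve b true  true  = true
resolve b false true  = b
resolve b true  false = b

resolve-platypus : ∀ b x y → platypus x y (resolve b x y)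
resolve-platypus b false false = refl
resolve-platypus b true  true  = refl
resolve-platypus b false true  = _
resolve-platypus b true  false = _

cutoff : ℕ → Formula → Bool
cutoff m (var zero)    = false
cutoff m (var (suc _)) = true
cutoff m (φ ◇ ψ)       =
  resolve (rightDepth (φ ◇ ψ) ≤ᵇ m) (cutoff m φ) (cutoff m ψ)

cutoff-valuation : ∀ m → IsValuation 𝔹◇ (cutoff m)
cutoff-valuation m φ ψ = resolve-platypus _ (cutoff m φ) (cutoff m ψ)

cutoff-below : ∀ {m n} → n ≤ m → cutoff m (chain n) ≡ true
cutoff-below {m} {zero}  n≤m = refl
cutoff-below {m} {suc n} n≤m
  rewrite cutoff-below (<⇒≤ n≤m) | rightDepth-chain n =
  Equivalence.to T-≡ (≤⇒≤ᵇ n≤m)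

cutoff-above : ∀ {m n} → m < n → cutoff m (chain n) ≡ false
cutoff-above {m} {suc n} m<n with cutoff m (chain n)
... | false = refl
... | true rewrite rightDepth-chain n =
  ¬-not (<⇒≱ m<n ∘ ≤ᵇ⇒≤ _ _ ∘ Equivalence.from T-≡)

chain-independent : ∀ {m n} → m < n → ¬ ⊢[ 𝔹◇ ] ｛ chain m ｝ (chain n)
chain-independent {m} m<n entails
  with entails (cutoff m) (cutoff-valuation m)
         (λ { (_ , refl , refl) → sym (cutoff-below {m} ≤-refl) })
... | _ , (_ , refl , refl) , is-true with trans is-true (cutoff-above m<n)
...   | ()

theorem1 : ¬ (Σ[ M ∈ Nmatrix ] (Finite M × Deterministic M × ((⊢[ 𝔹◇ ] ⇔ ⊢[ M ]) ⊎ (▷[ 𝔹◇ ] ⇔ ▷[ M ]))))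
theorem1 (M , fin , det , same) with chain-entails M det fin
theorem1 (M , fin , det , inj₁ (_ , M⇒𝔹)) | i , j , i<j , entails =
  chain-independent i<j (M⇒𝔹 entails)
-- Single-conclusion entailment unfolds to `▷` with a singleton on the right, so the same `entails`
-- refutes this case.
theorem1 (M , fin , det , inj₂ (_ , M⇒𝔹)) | i , j , i<j , entails =
  chain-independent i<j (M⇒𝔹 entails)
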